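{- For every quasiprimitive graph-restrictive permutation group $L$ and every positive constant $\alpha$ there exists an integer $N_{L,\alpha}$ with the following property: if $\Gamma$ is a finite connected simple graph, $X\le\mathrm{Aut}(\Gamma)$ acts transitively on the arcs of $\Gamma$, $|\mathrm V(\Gamma)|>N_{L,\alpha}$, and for every vertex $v$ the group $X_v^{\Gamma(v)}$ is permutation isomorphic to $L$, then $\mathrm{fpr}_{\mathrm V(\Gamma)}(g)<\alpha$ for every nontrivial element $g\in X$.
   Context: An arc is an ordered pair of adjacent vertices. $X_v^{\Gamma(v)}$ denotes the permutation group induced by the vertex-stabiliser $X_v$ on the neighbourhood $\Gamma(v)$. A permutation group is quasiprimitive if all its nontrivial normal subgroups (including itself) are transitive. A transitive permutation group $L$ is graph-restrictive if there is a constant $c(L)$ such that whenever $\Gamma$ is a graph and $G\le\mathrm{Aut}(\Gamma)$ is arc-transitive with $G_v^{\Gamma(v)}$ permutation isomorphic to $L$ for every vertex $v$, we have $|G_v|\le c(L)$. $\mathrm{fpr}_{\mathrm V(\Gamma)}(g)$ is the number of vertices fixed by $g$ divided by $|\mathrm V(\Gamma)|$. -}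

module Defs where

open import Data.Nat using (ℕ; zero; suc; _≤_; _<_)
open import Data.Fin using (Fin) renaming (_≟_ to _≟F_)
open import Data.Vec using (Vec; lookup; tabulate; allFin)
open import Data.List using (List; length; filter)
import Data.List as List
open import Data.List.Membership.Propositional using (_∈_)
open import Data.List.Relation.Unary.Unique.Propositional using (Unique)
open import Data.Bool using (Bool; true; false)
open import Data.Product using (Σ; ∃; _×_; _,_)
open import Data.Integer using (+_)
open import Data.Rational using (ℚ; 0ℚ; _/_)
open import Relation.Binary.PropositionalEquality using (_≡_; _≢_)
open import Function using (id)

-- Permutations of Fin n, stored as their value tables (so ≡ is
-- extensional equality of permutations).

Tab : ℕ → Set
Tab n = Vec (Fin n) n

_⟪_⟫ : ∀ {n} → Tab n → Fin n → Fin n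
σ ⟪ i ⟫ = lookup σ i

_∘ₜ_ : ∀ {n} → Tab n → Tab n → Tab n
σ ∘ₜ τ = tabulate (λ i → σ ⟪ τ ⟪ i ⟫ ⟫)

idₜ : ∀ {n} → Tab n
idₜ = tabulate id

IsPerm : ∀ {n} → Tab n → Set
IsPerm σ = ∀ i j → σ ⟪ i ⟫ ≡ σ ⟪ j ⟫ → i ≡ j

-- A (finite) permutation group of degree n: a duplicate-free list of
-- permutations of Fin n containing the identity and closed under
-- composition (for finite sets this makes it a subgroup of Sym(n)).
record PermGroup (n : ℕ) : Set where
  field
    elems   : List (Tab n)
    unique  : Unique elems
    perms   : ∀ σ → σ ∈ elems → IsPerm σ
    hasId   : idₜ ∈ elems
    closed  : ∀ σ τ → σ ∈ elems → τ ∈ elems → (σ ∘ₜ τ) ∈ elems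
open PermGroup public

∣_∣ᴳ : ∀ {n} → PermGroup n → ℕ
∣ G ∣ᴳ = length (elems G)

Transitive : ∀ {n} → PermGroup n → Set
Transitive {n} G = ∀ (i j : Fin n) → ∃ λ σ → σ ∈ elems G × σ ⟪ i ⟫ ≡ j

_≤ᴳ_ : ∀ {n} → PermGroup n → PermGroup n → Set
N ≤ᴳ G = ∀ σ → σ ∈ elems N → σ ∈ elems G

-- N is a normal subgroup of G: g N g⁻¹ ⊆ N, written as
-- for all g ∈ G, m ∈ N there is m' ∈ N with g m = m' g.
_⊴_ : ∀ {n} → PermGroup n → PermGroup n → Set
N ⊴ G = N ≤ᴳ G × (∀ g m → g ∈ elems G → m ∈ elems N →
          ∃ λ m' → m' ∈ elems N × (g ∘ₜ m) ≡ (m' ∘ₜ g))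

Nontrivial : ∀ {n} → PermGroup n → Set
Nontrivial G = ∃ λ σ → σ ∈ elems G × σ ≢ idₜ

Quasiprimitive : ∀ {n} → PermGroup n → Set
Quasiprimitive G = ∀ N → N ⊴ G → Nontrivial N → Transitive N

record Graph (n : ℕ) : Set where
  field
    adj   : Fin n → Fin n → Bool
    sym   : ∀ u v → adj u v ≡ adj v u
    irrefl : ∀ u → adj u u ≡ false
open Graph public

data Walk {n} (Γ : Graph n) : Fin n → Fin n → Set where
  here : ∀ {u} → Walk Γ u u
  step : ∀ {u v w} → adj Γ u v ≡ true → Walk Γ v w → Walk Γ u w

Connected : ∀ {n} → Graph n → Set
Connected {n} Γ = ∀ (u v : Fin n) → Walk Γ u v

IsAutGroup : ∀ {n} → Graph n → PermGroup n → Set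
IsAutGroup Γ G = ∀ σ → σ ∈ elems G → ∀ u v → adj Γ (σ ⟪ u ⟫) (σ ⟪ v ⟫) ≡ adj Γ u v

ArcTransitive : ∀ {n} → Graph n → PermGroup n → Set
ArcTransitive Γ G = ∀ u v u' v' → adj Γ u v ≡ true → adj Γ u' v' ≡ true →
  ∃ λ σ → σ ∈ elems G × σ ⟪ u ⟫ ≡ u' × σ ⟪ v ⟫ ≡ v'

stab : ∀ {n} → PermGroup n → Fin n → List (Tab n)
stab G v = filter (λ σ → σ ⟪ v ⟫ ≟F v) (elems G)

∣stab∣ : ∀ {n} → PermGroup n → Fin n → ℕ
∣stab∣ G v = length (stab G v)

-- G_v^{Γ(v)} is permutation isomorphic to L (degree d): there is a
-- bijection β : Fin d → Γ(v) such that the permutations of Γ(v) induced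
-- by G_v are exactly the β-conjugates of the elements of L.
LocallyIso : ∀ {n d} → Graph n → PermGroup n → Fin n → PermGroup d → Set
LocallyIso {n} {d} Γ G v L = Σ (Fin d → Fin n) λ β →
    (∀ i j → β i ≡ β j → i ≡ j)
  × (∀ i → adj Γ v (β i) ≡ true)
  × (∀ w → adj Γ v w ≡ true → ∃ λ i → β i ≡ w)
  × (∀ σ → σ ∈ elems G → σ ⟪ v ⟫ ≡ v →
       ∃ λ τ → τ ∈ elems L × (∀ i → σ ⟪ β i ⟫ ≡ β (τ ⟪ i ⟫)))
  × (∀ τ → τ ∈ elems L →
       ∃ λ σ → σ ∈ elems G × σ ⟪ v ⟫ ≡ v × (∀ i → σ ⟪ β i ⟫ ≡ β (τ ⟪ i ⟫)))

GraphRestrictive : ∀ {d} → PermGroup d → Set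
GraphRestrictive L = Σ ℕ λ c →
  ∀ n (Γ : Graph n) (G : PermGroup n) → Connected Γ → IsAutGroup Γ G →
  ArcTransitive Γ G → (∀ v → LocallyIso Γ G v L) →
  ∀ v → ∣stab∣ G v ≤ c

fixCount : ∀ {n} → Tab n → ℕ
fixCount {n} g = length (filter (λ i → g ⟪ i ⟫ ≟F i) (List.allFin n))

fpr : ∀ {n} → Tab n → ℚ
fpr {zero} g = 0ℚ
fpr {suc n} g = (+ fixCount g) / suc n

{-# OPTIONS --safe #-}

-- Suppose g ≠ 1 fixes at least α|V| vertices. Counting pairs (s, v) with
-- s ∈ g^X and s v = v gives |g^X| ≤ c/α, where c bounds the vertex
-- stabilisers; moreover g fixes a vertex, so its order is at most c.
-- By Dietzmann's lemma the normal closure M of g in X then has order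
-- bounded in terms of c and α. Since M contains a nontrivial element fixing a
-- vertex, quasiprimitivity makes M locally transitive at every vertex, so
-- M has at most two orbits on vertices and |V| ≤ 2|M|.
module Submission where

open import Defs
open import Data.Bool using (true)
open import Data.Empty using (⊥-elim)
open import Data.Fin using (Fin; zero; suc; toℕ) renaming (_≟_ to _≟F_)
open import Data.Fin.Properties using (all?; injective⇒≤; pigeonhole; toℕ<n) renaming (any? to any?ᶠ)
import Data.Integer as ℤ
import Data.Integer.Properties as ℤₚ
open import Data.List using (List; []; _∷_; _++_; length; map; filter; foldr; allFin; cartesianProductWith; lookup)
open import Data.List.Membership.Propositional using (_∈_; find; lose)
open import Data.List.Membership.Propositional.Properties using (∈-allFin; ∈-cartesianProductWith⁺; ∈-cartesianProductWith⁻; ∈-filter⁺; ∈-filter⁻; ∈-lookup; ∈-map⁺; ∈-++⁺ˡ; ∈-++⁺ʳ; ∈-++⁻)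
open import Data.List.Properties using (length-map; length-++; length-tabulate)
import Data.List.Relation.Binary.Sublist.Propositional.Properties as Sublist
open import Data.List.Relation.Unary.All using (All; []; _∷_)
import Data.List.Relation.Unary.All as All
import Data.List.Relation.Unary.All.Properties as Allₚ
open import Data.List.Relation.Unary.Any using (Any; here; there; any?; index)
open import Data.List.Relation.Unary.Any.Properties using (lookup-index)
open import Data.List.Relation.Unary.AllPairs using (_∷_)
open import Data.List.Relation.Unary.Unique.Propositional using (Unique)
import Data.List.Relation.Unary.Unique.Propositional.Properties as Uniqueₚ
open import Data.Nat using (ℕ; zero; suc; _+_; _*_; _^_; _≤_; _<_; z≤n; s≤s; s≤s⁻¹; >-nonZero; _≤?_)
open import Data.Nat.ListAction using (sum)
open import Data.Nat.Properties
open import Algebra.Properties.CommutativeSemigroup +-commutativeSemigroup using (x∙yz≈y∙xz)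
open import Data.Product using (Σ; ∃; _×_; _,_; proj₁; proj₂)
open import Data.Rational using (ℚ; mkℚ; Positive; ↧ₙ_) renaming (_<_ to _<ℚ_; _≤_ to _≤ℚ_)
import Data.Rational.Properties as ℚₚ
import Data.Rational.Unnormalised as ℚᵘ
import Data.Rational.Unnormalised.Properties as ℚᵘₚ
open import Data.Sum using (_⊎_; inj₁; inj₂)
open import Data.Vec.Properties using (lookup∘tabulate; tabulate∘lookup; tabulate-cong) renaming (≡-dec to Vec-≡-dec)
open import Function using (_∘_)
open import Relation.Binary.PropositionalEquality using (_≡_; _≢_; refl; trans; cong; cong₂; subst; subst₂; module ≡-Reasoning) renaming (sym to ≡-sym)
open import Relation.Nullary using (¬_; Dec; yes; no; ¬?)
open import Relation.Nullary.Decidable using (_×-dec_; decidable-stable)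
open import Relation.Unary using (Decidable)

-- Lists and counting

lookup-injective : ∀ {A : Set} {xs : List A} → Unique xs →
  ∀ i j → lookup xs i ≡ lookup xs j → i ≡ j
lookup-injective (x∉ ∷ u) zero    zero    eq = refl
lookup-injective (x∉ ∷ u) zero    (suc j) eq = ⊥-elim (All.lookup x∉ (∈-lookup j) eq)
lookup-injective (x∉ ∷ u) (suc i) zero    eq = ⊥-elim (All.lookup x∉ (∈-lookup i) (≡-sym eq))
lookup-injective (x∉ ∷ u) (suc i) (suc j) eq = cong suc (lookup-injective u i j eq)

index-injective : ∀ {A : Set} {xs : List A} {x y} (p : x ∈ xs) (q : y ∈ xs) →
  index p ≡ index q → x ≡ y
index-injective {xs = xs} p q eq =
  trans (lookup-index p) (trans (cong (lookup xs) eq) (≡-sym (lookup-index q)))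

-- Positions of `xs` are sent to positions of `ys`, so lists with repetitions, such as `products` or
-- concatenated orbits, serve as upper bounds.
length-≤-injection : ∀ {A B : Set} {xs : List A} {ys : List B} → Unique xs →
  (f : A → B) → (∀ x y → f x ≡ f y → x ≡ y) → (∀ x → x ∈ xs → f x ∈ ys) →
  length xs ≤ length ys
length-≤-injection {xs = xs} u f f-inj f∈ =
  injective⇒≤ {f = λ i → index (f∈ (lookup xs i) (∈-lookup i))}
    (λ {i} {j} eq → lookup-injective u i j (f-inj _ _ (index-injective (f∈ _ (∈-lookup i)) (f∈ _ (∈-lookup j)) eq)))

length-cartesianProductWith : ∀ {A B C : Set} (f : A → B → C) xs ys →
  length (cartesianProductWith f xs ys) ≡ length xs * length ys
length-cartesianProductWith f []       ys = refl
length-cartesianProductWith f (x ∷ xs) ys =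
  trans (length-++ (map (f x) ys))
        (cong₂ _+_ (length-map (f x) ys) (length-cartesianProductWith f xs ys))

sum-map-≤ : ∀ {A : Set} (f : A → ℕ) (c : ℕ) → ∀ xs → (∀ x → f x ≤ c) →
  sum (map f xs) ≤ length xs * c
sum-map-≤ f c []       f≤c = z≤n
sum-map-≤ f c (x ∷ xs) f≤c = +-mono-≤ (f≤c x) (sum-map-≤ f c xs f≤c)

module _ {A B : Set} {R : A → B → Set} (R? : ∀ a b → Dec (R a b)) where

  row : List B → A → ℕ
  row bs a = length (filter (R? a) bs)

  column : List A → B → ℕ
  column as b = length (filter (λ a → R? a b) as)

  -- Adding `a` lengthens the column of `b` by one exactly when `R a b` holds; these increments add
  -- up to the row of `a`.
  column-∷ : ∀ a as bs →
    sum (map (column (a ∷ as)) bs) ≡ row bs a + sum (map (column as) bs)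
  column-∷ a as []       = refl
  column-∷ a as (b ∷ bs) with R? a b
  ... | yes _ = cong suc (trans (cong (column as b +_) (column-∷ a as bs))
                                (x∙yz≈y∙xz (column as b) (row bs a) _))
  ... | no  _ = trans (cong (column as b +_) (column-∷ a as bs))
                      (x∙yz≈y∙xz (column as b) (row bs a) _)

  rows≤columns : ∀ f as bs → (∀ a → a ∈ as → f ≤ row bs a) →
    length as * f ≤ sum (map (column as) bs)
  rows≤columns f []       bs f≤row = z≤n
  rows≤columns f (a ∷ as) bs f≤row =
    ≤-trans (+-mono-≤ (f≤row a (here refl)) (rows≤columns f as bs (λ x x∈ → f≤row x (there x∈))))
            (≤-reflexive (≡-sym (column-∷ a as bs)))

  -- Both sides estimate the number of related pairs, from below by rows and from above by columns.
  doubleCounting : ∀ f c as bs → (∀ a → a ∈ as → f ≤ row bs a) →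
    (∀ b → column as b ≤ c) → length as * f ≤ length bs * c
  doubleCounting f c as bs f≤row col≤c =
    ≤-trans (rows≤columns f as bs f≤row) (sum-map-≤ (column as) c bs col≤c)

length-filter-split : ∀ {A : Set} {P : A → Set} (P? : Decidable P) xs →
  length xs ≡ length (filter P? xs) + length (filter (¬? ∘ P?) xs)
length-filter-split P? [] = refl
length-filter-split P? (x ∷ xs) with P? x
... | yes _ = cong suc (length-filter-split P? xs)
... | no  _ = trans (cong suc (length-filter-split P? xs)) (≡-sym (+-suc _ _))

-- Permutation tables

_≟ₜ_ : ∀ {n} (σ τ : Tab n) → Dec (σ ≡ τ)
_≟ₜ_ = Vec-≡-dec _≟F_

module _ {n : ℕ} where

  tab-ext : {σ τ : Tab n} → (∀ i → σ ⟪ i ⟫ ≡ τ ⟪ i ⟫) → σ ≡ τ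
  tab-ext {σ} {τ} eq =
    trans (≡-sym (tabulate∘lookup σ)) (trans (tabulate-cong eq) (tabulate∘lookup τ))

  ∘ₜ-app : ∀ (σ τ : Tab n) i → (σ ∘ₜ τ) ⟪ i ⟫ ≡ σ ⟪ τ ⟪ i ⟫ ⟫
  ∘ₜ-app σ τ = lookup∘tabulate _

  idₜ-app : ∀ i → idₜ {n} ⟪ i ⟫ ≡ i
  idₜ-app = lookup∘tabulate _

  app-cong : {σ τ : Tab n} → σ ≡ τ → ∀ i → σ ⟪ i ⟫ ≡ τ ⟪ i ⟫
  app-cong refl i = refl

  app-square : ∀ (a b c d : Tab n) → a ∘ₜ b ≡ c ∘ₜ d → ∀ i → a ⟪ b ⟪ i ⟫ ⟫ ≡ c ⟪ d ⟪ i ⟫ ⟫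
  app-square a b c d eq i =
    trans (≡-sym (∘ₜ-app a b i)) (trans (app-cong eq i) (∘ₜ-app c d i))

  ∘ₜ-assoc : ∀ (ρ σ τ : Tab n) → (ρ ∘ₜ σ) ∘ₜ τ ≡ ρ ∘ₜ (σ ∘ₜ τ)
  ∘ₜ-assoc ρ σ τ = tab-ext λ i → begin
    ((ρ ∘ₜ σ) ∘ₜ τ) ⟪ i ⟫   ≡⟨ ∘ₜ-app (ρ ∘ₜ σ) τ i ⟩
    (ρ ∘ₜ σ) ⟪ τ ⟪ i ⟫ ⟫    ≡⟨ ∘ₜ-app ρ σ _ ⟩
    ρ ⟪ σ ⟪ τ ⟪ i ⟫ ⟫ ⟫     ≡⟨ cong (ρ ⟪_⟫) (∘ₜ-app σ τ i) ⟨
    ρ ⟪ (σ ∘ₜ τ) ⟪ i ⟫ ⟫    ≡⟨ ∘ₜ-app ρ (σ ∘ₜ τ) i ⟨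
    (ρ ∘ₜ (σ ∘ₜ τ)) ⟪ i ⟫   ∎
    where open ≡-Reasoning

  ∘ₜ-identityˡ : ∀ (σ : Tab n) → idₜ ∘ₜ σ ≡ σ
  ∘ₜ-identityˡ σ = tab-ext λ i → trans (∘ₜ-app idₜ σ i) (idₜ-app _)

  ∘ₜ-identityʳ : ∀ (σ : Tab n) → σ ∘ₜ idₜ ≡ σ
  ∘ₜ-identityʳ σ = tab-ext λ i → trans (∘ₜ-app σ idₜ i) (cong (σ ⟪_⟫) (idₜ-app i))

  ∘ₜ-cancelˡ : ∀ (h : Tab n) → IsPerm h → ∀ σ τ → h ∘ₜ σ ≡ h ∘ₜ τ → σ ≡ τ
  ∘ₜ-cancelˡ h h-perm σ τ eq = tab-ext λ i → h-perm _ _ (app-square h σ h τ eq i)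

  app-inverse : ∀ (σ τ : Tab n) → σ ∘ₜ τ ≡ idₜ → ∀ i → σ ⟪ τ ⟪ i ⟫ ⟫ ≡ i
  app-inverse σ τ eq i = trans (≡-sym (∘ₜ-app σ τ i)) (trans (app-cong eq i) (idₜ-app i))

  conjugate-fixes : ∀ (h x y : Tab n) → h ∘ₜ x ≡ y ∘ₜ h →
    ∀ v → h ⟪ v ⟫ ≡ v → x ⟪ v ⟫ ≡ v → y ⟪ v ⟫ ≡ v
  conjugate-fixes h x y hx≡yh v hv≡v xv≡v = begin
    y ⟪ v ⟫           ≡⟨ cong (y ⟪_⟫) hv≡v ⟨
    y ⟪ h ⟪ v ⟫ ⟫     ≡⟨ app-square h x y h hx≡yh v ⟨
    h ⟪ x ⟪ v ⟫ ⟫     ≡⟨ cong (h ⟪_⟫) xv≡v ⟩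
    h ⟪ v ⟫           ≡⟨ hv≡v ⟩
    v                 ∎
    where open ≡-Reasoning

  movedPoint : ∀ (σ : Tab n) → σ ≢ idₜ → ∃ λ u → σ ⟪ u ⟫ ≢ u
  movedPoint σ σ≢id with any?ᶠ (λ u → ¬? (σ ⟪ u ⟫ ≟F u))
  ... | yes moved   = moved
  ... | no  unmoved = ⊥-elim (σ≢id (tab-ext λ u →
          trans (decidable-stable (σ ⟪ u ⟫ ≟F u) (λ σu≢u → unmoved (u , σu≢u))) (≡-sym (idₜ-app u))))

  slide : ∀ (a b c d e : Tab n) → a ∘ₜ b ≡ c ∘ₜ d → a ∘ₜ (b ∘ₜ e) ≡ c ∘ₜ (d ∘ₜ e)
  slide a b c d e eq =
    trans (≡-sym (∘ₜ-assoc a b e)) (trans (cong (_∘ₜ e) eq) (∘ₜ-assoc c d e))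

  -- Powers, orders and inverses

  pow : Tab n → ℕ → Tab n
  pow σ zero    = idₜ
  pow σ (suc k) = σ ∘ₜ pow σ k

  pow-closed : (P : Tab n → Set) → P idₜ → (∀ σ τ → P σ → P τ → P (σ ∘ₜ τ)) →
    ∀ σ → P σ → ∀ k → P (pow σ k)
  pow-closed P Pid P∘ σ Pσ zero    = Pid
  pow-closed P Pid P∘ σ Pσ (suc k) = P∘ σ _ Pσ (pow-closed P Pid P∘ σ Pσ k)

  -- Cancelling `σ` on the left `i` times leaves the identity equal to a positive power with
  -- exponent at most `j`.
  pow-cancel : ∀ σ → IsPerm σ → ∀ i j → i < j → pow σ i ≡ pow σ j →
    ∃ λ r → suc r ≤ j × pow σ (suc r) ≡ idₜ
  pow-cancel σ σ-perm zero    (suc j) _         eq = j , ≤-refl , ≡-sym eq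
  pow-cancel σ σ-perm (suc i) (suc j) (s≤s i<j) eq
    with r , r<j , σʳ≡id ← pow-cancel σ σ-perm i j i<j (∘ₜ-cancelˡ σ σ-perm (pow σ i) (pow σ j) eq)
    = r , m≤n⇒m≤1+n r<j , σʳ≡id

  order-≤ : ∀ σ → IsPerm σ → (xs : List (Tab n)) → (∀ k → pow σ k ∈ xs) →
    ∃ λ r → suc r ≤ length xs × pow σ (suc r) ≡ idₜ
  order-≤ σ σ-perm xs pow∈
    -- The exponents run from 0 to `length xs`, one more than there are entries, so two powers share
    -- a position and the larger exponent is at most `length xs`.
    with i , j , i<j , eq ← pigeonhole (n<1+n (length xs)) (λ i → index (pow∈ (toℕ i)))
    with r , r<j , σʳ≡id ← pow-cancel σ σ-perm (toℕ i) (toℕ j) i<j (index-injective (pow∈ (toℕ i)) (pow∈ (toℕ j)) eq)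
    = r , ≤-trans r<j (s≤s⁻¹ (toℕ<n j)) , σʳ≡id

  pow-intertwine : ∀ (a h b : Tab n) → a ∘ₜ h ≡ h ∘ₜ b → ∀ k → pow a k ∘ₜ h ≡ h ∘ₜ pow b k
  pow-intertwine a h b eq zero = trans (∘ₜ-identityˡ h) (≡-sym (∘ₜ-identityʳ h))
  pow-intertwine a h b eq (suc k) = begin
    (a ∘ₜ pow a k) ∘ₜ h   ≡⟨ ∘ₜ-assoc a (pow a k) h ⟩
    a ∘ₜ (pow a k ∘ₜ h)   ≡⟨ cong (a ∘ₜ_) (pow-intertwine a h b eq k) ⟩
    a ∘ₜ (h ∘ₜ pow b k)   ≡⟨ slide a h h b (pow b k) eq ⟩
    h ∘ₜ (b ∘ₜ pow b k)   ∎
    where open ≡-Reasoning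

  module _ (X : PermGroup n) where

    -- `PermGroup` records no inverses; finiteness supplies them, since `h` to the power `suc r` is
    -- the identity and `pow h r` is then a right inverse. Cancelling `h` on the left makes it a
    -- left inverse too.
    inverse : ∀ h → h ∈ elems X → ∃ λ h⁻¹ → h⁻¹ ∈ elems X × h ∘ₜ h⁻¹ ≡ idₜ × h⁻¹ ∘ₜ h ≡ idₜ
    inverse h h∈X =
      let h-perm = perms X h h∈X
          pow∈ = pow-closed (_∈ elems X) (hasId X) (closed X) h h∈X
          r , _ , hh⁻¹ = order-≤ h h-perm (elems X) pow∈
      in pow h r , pow∈ r , hh⁻¹ , ∘ₜ-cancelˡ h h-perm (pow h r ∘ₜ h) idₜ (begin
           h ∘ₜ (pow h r ∘ₜ h)   ≡⟨ ∘ₜ-assoc h (pow h r) h ⟨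
           (h ∘ₜ pow h r) ∘ₜ h   ≡⟨ cong (_∘ₜ h) hh⁻¹ ⟩
           idₜ ∘ₜ h              ≡⟨ ∘ₜ-identityˡ h ⟩
           h                     ≡⟨ ∘ₜ-identityʳ h ⟨
           h ∘ₜ idₜ              ∎)
      where open ≡-Reasoning

    -- All powers of `g` lie in the stabiliser of `v`, so its size bounds the order.
    order-≤-stab : ∀ g v → g ∈ elems X → g ⟪ v ⟫ ≡ v →
      ∃ λ r → suc r ≤ ∣stab∣ X v × pow g (suc r) ≡ idₜ
    order-≤-stab g v g∈X gv≡v = order-≤ g (perms X g g∈X) (stab X v) λ k →
      let pow∈X , powv≡v = pow-closed (λ σ → σ ∈ elems X × σ ⟪ v ⟫ ≡ v)
            (hasId X , idₜ-app v)
            (λ { σ τ (σ∈ , σv) (τ∈ , τv) →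
                 closed X σ τ σ∈ τ∈ , trans (∘ₜ-app σ τ v) (trans (cong (σ ⟪_⟫) τv) σv) })
            g (g∈X , gv≡v) k
      in ∈-filter⁺ (λ σ → σ ⟪ v ⟫ ≟F v) pow∈X powv≡v

-- Dietzmann's lemma

module _ {n : ℕ} where

  prod : List (Tab n) → Tab n
  prod = foldr _∘ₜ_ idₜ

  prod-++ : ∀ v w → prod (v ++ w) ≡ prod v ∘ₜ prod w
  prod-++ []      w = ≡-sym (∘ₜ-identityˡ (prod w))
  prod-++ (x ∷ v) w = trans (cong (x ∘ₜ_) (prod-++ v w)) (≡-sym (∘ₜ-assoc x (prod v) (prod w)))

  -- These are the values of words of length at most `k`: the first summand retains the shorter
  -- ones. Repetitions are kept, which makes the length an exact power.
  products : List (Tab n) → ℕ → List (Tab n)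
  products S zero    = idₜ ∷ []
  products S (suc k) = products S k ++ cartesianProductWith _∘ₜ_ S (products S k)

  length-products : ∀ S k → length (products S k) ≡ suc (length S) ^ k
  length-products S zero    = refl
  length-products S (suc k) = begin
    length (products S k ++ cartesianProductWith _∘ₜ_ S (products S k))
      ≡⟨ length-++ (products S k) ⟩
    length (products S k) + length (cartesianProductWith _∘ₜ_ S (products S k))
      ≡⟨ cong (λ x → length (products S k) + x) (length-cartesianProductWith _∘ₜ_ S (products S k)) ⟩
    suc (length S) * length (products S k)
      ≡⟨ cong (suc (length S) *_) (length-products S k) ⟩
    suc (length S) ^ suc k ∎
    where open ≡-Reasoning

  ∈-products⁺ : ∀ {S} k {w} → All (_∈ S) w → length w ≤ k → prod w ∈ products S k
  ∈-products⁺ zero    []        _         = here refl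
  ∈-products⁺ (suc k) []        _         = ∈-++⁺ˡ (∈-products⁺ k [] z≤n)
  ∈-products⁺ {S} (suc k) (x∈ ∷ w∈) (s≤s ∣w∣≤k) =
    ∈-++⁺ʳ (products S k) (∈-cartesianProductWith⁺ _∘ₜ_ x∈ (∈-products⁺ k w∈ ∣w∣≤k))

  ∈-products⁻ : ∀ {S} k {x} → x ∈ products S k → ∃ λ w → All (_∈ S) w × x ≡ prod w
  ∈-products⁻ zero (here refl) = [] , [] , refl
  ∈-products⁻ {S} (suc k) x∈ with ∈-++⁻ (products S k) x∈
  ... | inj₁ x∈ˡ = ∈-products⁻ k x∈ˡ
  ... | inj₂ x∈ʳ
    with s , y , s∈ , y∈ , refl ← ∈-cartesianProductWith⁻ _∘ₜ_ S (products S k) x∈ʳ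
    with w , w∈ , refl ← ∈-products⁻ k y∈
    = s ∷ w , s∈ ∷ w∈ , refl

  occurrences : Tab n → List (Tab n) → ℕ
  occurrences s w = length (filter (s ≟ₜ_) w)

  -- Pigeonhole on letters: if the first letter of the alphabet occurs fewer than `c` times, delete
  -- it and continue with the smaller alphabet.
  frequent : ∀ c S w → All (_∈ S) w → length S * c < length w →
    ∃ λ s → s ∈ S × c ≤ occurrences s w
  frequent c []      (_ ∷ _) (() ∷ _) _
  frequent c (s ∷ S) w w∈ long with c ≤? occurrences s w
  ... | yes c≤ = s , here refl , c≤
  ... | no  c≰ =
    let t , t∈S , c≤t = frequent c S w′ (All.tabulate w′∈) long′
    in t , there t∈S , ≤-trans c≤t (Sublist.length-mono-≤ (Sublist.filter⁺ (t ≟ₜ_) (t ≟ₜ_) (λ { refl p → p }) (Sublist.filter-⊆ (¬? ∘ (s ≟ₜ_)) w)))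
    where
    w′ = filter (¬? ∘ (s ≟ₜ_)) w
    w′∈ : ∀ {x} → x ∈ w′ → x ∈ S
    w′∈ x∈w′ with x∈w , s≢x ← ∈-filter⁻ (¬? ∘ (s ≟ₜ_)) x∈w′ with All.lookup w∈ x∈w
    ... | here x≡s = ⊥-elim (s≢x (≡-sym x≡s))
    ... | there x∈S = x∈S
    -- Deleting `s` costs at most `c` letters, which matches the summand `c` that the alphabet bound
    -- loses.
    long′ : length S * c < length w′
    long′ = +-cancelˡ-< c _ _ (<-≤-trans long
      (≤-trans (≤-reflexive (length-filter-split (s ≟ₜ_) w)) (+-monoˡ-≤ (length w′) (<⇒≤ (≰⇒> c≰)))))

  module Dietzmann (S : List (Tab n))
    (conjugate : ∀ x s → x ∈ S → s ∈ S → ∃ λ y → y ∈ S × x ∘ₜ s ≡ s ∘ₜ y)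
    (c : ℕ) (order : ∀ s → s ∈ S → ∃ λ r → suc r ≤ c × pow s (suc r) ≡ idₜ) where

    -- Conjugating by `s` repeatedly keeps a letter inside `S`, so a letter can pass a whole block
    -- of copies of `s`.
    conjugate-pow : ∀ x s → x ∈ S → s ∈ S → ∀ k → ∃ λ y → y ∈ S × x ∘ₜ pow s k ≡ pow s k ∘ₜ y
    conjugate-pow x s x∈ s∈ zero = x , x∈ , trans (∘ₜ-identityʳ x) (≡-sym (∘ₜ-identityˡ x))
    conjugate-pow x s x∈ s∈ (suc k) =
      let y , y∈ , xs≡sy = conjugate x s x∈ s∈
          z , z∈ , ys≡sz = conjugate-pow y s y∈ s∈ k
      in z , z∈ , (begin
           x ∘ₜ (s ∘ₜ pow s k)   ≡⟨ slide x s s y (pow s k) xs≡sy ⟩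
           s ∘ₜ (y ∘ₜ pow s k)   ≡⟨ cong (s ∘ₜ_) ys≡sz ⟩
           s ∘ₜ (pow s k ∘ₜ z)   ≡⟨ ∘ₜ-assoc s (pow s k) z ⟨
           pow s (suc k) ∘ₜ z    ∎)
      where open ≡-Reasoning

    -- Occurrences of s are moved to the front of a word by conjugating the letters they pass.
    collect : ∀ s → s ∈ S → ∀ k w → All (_∈ S) w → k ≤ occurrences s w →
      ∃ λ w′ → All (_∈ S) w′ × prod w ≡ pow s k ∘ₜ prod w′ × length w ≡ k + length w′
    collect s s∈ zero    w w∈ _ = w , w∈ , ≡-sym (∘ₜ-identityˡ (prod w)) , refl
    collect s s∈ (suc k) (x ∷ w) (x∈ ∷ w∈) k≤ with s ≟ₜ x
    ... | yes refl =
      let w′ , w′∈ , eq , len = collect s s∈ k w w∈ (s≤s⁻¹ k≤)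
      in w′ , w′∈ , trans (cong (s ∘ₜ_) eq) (≡-sym (∘ₜ-assoc s (pow s k) (prod w′))) , cong suc len
    ... | no _ =
      let w′ , w′∈ , eq , len = collect s s∈ (suc k) w w∈ k≤
          y , y∈ , xs≡sy = conjugate-pow x s x∈ s∈ (suc k)
      in y ∷ w′ , y∈ ∷ w′∈ , trans (cong (x ∘ₜ_) eq) (slide x (pow s (suc k)) (pow s (suc k)) y (prod w′) xs≡sy)
         , trans (cong suc len) (≡-sym (+-suc (suc k) (length w′)))

    shorten : ∀ w → All (_∈ S) w → length S * c < length w →
      ∃ λ w′ → All (_∈ S) w′ × prod w ≡ prod w′ × length w′ < length w
    shorten w w∈ long =
      let s , s∈ , c≤ = frequent c S w w∈ long
          r , r<c , sʳ≡id = order s s∈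
          w′ , w′∈ , eq , len = collect s s∈ (suc r) w w∈ (≤-trans r<c c≤)
      in w′ , w′∈ , trans eq (trans (cong (_∘ₜ prod w′) sʳ≡id) (∘ₜ-identityˡ (prod w′)))
         , ≤-trans (s≤s (m≤n+m (length w′) r)) (≤-reflexive (≡-sym len))

    -- `k` bounds the length and serves as the recursion measure, since each shortening is strict.
    shortWord : ∀ k w → length w ≤ k → All (_∈ S) w →
      ∃ λ w′ → All (_∈ S) w′ × prod w ≡ prod w′ × length w′ ≤ length S * c
    shortWord k w ∣w∣≤k w∈ with length w ≤? length S * c
    ... | yes short = w , w∈ , refl , short
    shortWord zero    w ∣w∣≤k w∈ | no long = ⊥-elim (long (≤-trans ∣w∣≤k z≤n))
    shortWord (suc k) w ∣w∣≤k w∈ | no long =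
      let w₁ , w₁∈ , eq₁ , shorter = shorten w w∈ (≰⇒> long)
          w₂ , w₂∈ , eq₂ , short = shortWord k w₁ (s≤s⁻¹ (≤-trans shorter ∣w∣≤k)) w₁∈
      in w₂ , w₂∈ , trans eq₁ eq₂ , short

    prod∈products : ∀ w → All (_∈ S) w → prod w ∈ products S (length S * c)
    prod∈products w w∈ =
      let w′ , w′∈ , eq , short = shortWord (length w) w ≤-refl w∈
      in subst (_∈ products S (length S * c)) (≡-sym eq) (∈-products⁺ _ w′∈ short)

-- Conjugacy classes and normal closures

module ConjugacyClass {n : ℕ} (X : PermGroup n) (g : Tab n) (g∈X : g ∈ elems X) where

  -- The equation expresses that `s` is the conjugate of `g` by `h` without mentioning inverses, and
  -- is decided by searching `elems X`.
  IsConjugate : Tab n → Set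
  IsConjugate s = Any (λ h → g ∘ₜ h ≡ h ∘ₜ s) (elems X)

  isConjugate? : ∀ s → Dec (IsConjugate s)
  isConjugate? s = any? (λ h → (g ∘ₜ h) ≟ₜ (h ∘ₜ s)) (elems X)

  conjugates : List (Tab n)
  conjugates = filter isConjugate? (elems X)

  ∈-conjugates⁻ : ∀ {s} → s ∈ conjugates →
    s ∈ elems X × ∃ λ h → h ∈ elems X × g ∘ₜ h ≡ h ∘ₜ s
  ∈-conjugates⁻ s∈ with s∈X , conj ← ∈-filter⁻ isConjugate? {xs = elems X} s∈ = s∈X , find conj

  self∈conjugates : g ∈ conjugates
  self∈conjugates = ∈-filter⁺ isConjugate? g∈X
    (lose (hasId X) (trans (∘ₜ-identityʳ g) (≡-sym (∘ₜ-identityˡ g))))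

  -- If `k` conjugates `g` to `x`, then `k ∘ₜ h` conjugates `g` to `y`.
  conjugates-closed : ∀ x h → x ∈ conjugates → h ∈ elems X →
    ∃ λ y → y ∈ conjugates × x ∘ₜ h ≡ h ∘ₜ y
  conjugates-closed x h x∈ h∈X =
    let x∈X , k , k∈X , gk≡kx = ∈-conjugates⁻ x∈
        h⁻¹ , h⁻¹∈X , hh⁻¹ , _ = inverse X h h∈X
        y = h⁻¹ ∘ₜ (x ∘ₜ h)
        xh≡hy : x ∘ₜ h ≡ h ∘ₜ y
        xh≡hy = begin
          x ∘ₜ h                     ≡⟨ ∘ₜ-identityˡ (x ∘ₜ h) ⟨
          idₜ ∘ₜ (x ∘ₜ h)            ≡⟨ cong (_∘ₜ (x ∘ₜ h)) hh⁻¹ ⟨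
          (h ∘ₜ h⁻¹) ∘ₜ (x ∘ₜ h)     ≡⟨ ∘ₜ-assoc h h⁻¹ (x ∘ₜ h) ⟩
          h ∘ₜ y                     ∎
        gkh≡khy : g ∘ₜ (k ∘ₜ h) ≡ (k ∘ₜ h) ∘ₜ y
        gkh≡khy = begin
          g ∘ₜ (k ∘ₜ h)   ≡⟨ slide g k k x h gk≡kx ⟩
          k ∘ₜ (x ∘ₜ h)   ≡⟨ cong (k ∘ₜ_) xh≡hy ⟩
          k ∘ₜ (h ∘ₜ y)   ≡⟨ ∘ₜ-assoc k h y ⟨
          (k ∘ₜ h) ∘ₜ y   ∎
    in y , ∈-filter⁺ isConjugate? (closed X h⁻¹ _ h⁻¹∈X (closed X x h x∈X h∈X))
             (lose (closed X k h k∈X h∈X) gkh≡khy)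
         , xh≡hy
    where open ≡-Reasoning

  -- When `h` conjugates `g` to `s`, its inverse carries the fixed points of `g` injectively to
  -- fixed points of `s`.
  fixCount-conjugate : ∀ s → s ∈ conjugates → fixCount g ≤ fixCount s
  fixCount-conjugate s s∈ =
    let s∈X , h , h∈X , gh≡hs = ∈-conjugates⁻ s∈
        h⁻¹ , h⁻¹∈X , hh⁻¹ , _ = inverse X h h∈X
    in length-≤-injection (Uniqueₚ.filter⁺ (λ i → g ⟪ i ⟫ ≟F i) (Uniqueₚ.allFin⁺ n))
         (h⁻¹ ⟪_⟫) (perms X h⁻¹ h⁻¹∈X)
         λ i i∈ → ∈-filter⁺ (λ i → s ⟪ i ⟫ ≟F i) (∈-allFin (h⁻¹ ⟪ i ⟫)) (perms X h h∈X _ _ (begin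
           h ⟪ s ⟪ h⁻¹ ⟪ i ⟫ ⟫ ⟫   ≡⟨ app-square g h h s gh≡hs (h⁻¹ ⟪ i ⟫) ⟨
           g ⟪ h ⟪ h⁻¹ ⟪ i ⟫ ⟫ ⟫   ≡⟨ cong (g ⟪_⟫) (app-inverse h h⁻¹ hh⁻¹ i) ⟩
           g ⟪ i ⟫                 ≡⟨ proj₂ (∈-filter⁻ (λ i → g ⟪ i ⟫ ≟F i) {xs = allFin n} i∈) ⟩
           i                       ≡⟨ app-inverse h h⁻¹ hh⁻¹ i ⟨
           h ⟪ h⁻¹ ⟪ i ⟫ ⟫         ∎))
    where open ≡-Reasoning

  -- The pairs counted are a conjugate and a vertex it fixes; the column of `v` is a sublist of
  -- `stab X v`.
  class*fixCount-≤ : ∀ c → (∀ v → ∣stab∣ X v ≤ c) → length conjugates * fixCount g ≤ n * c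
  class*fixCount-≤ c stab≤c =
    ≤-trans
      (doubleCounting (λ s v → s ⟪ v ⟫ ≟F v) (fixCount g) c conjugates (allFin n) fixCount-conjugate
        λ v → ≤-trans
          (Sublist.length-mono-≤ (Sublist.filter⁺ (λ σ → σ ⟪ v ⟫ ≟F v) (λ σ → σ ⟪ v ⟫ ≟F v)
            (λ { refl p → p }) (Sublist.filter-⊆ isConjugate? (elems X))))
          (stab≤c v))
      (≤-reflexive (cong (_* c) (length-tabulate (λ (i : Fin n) → i))))

  -- Here `q` says that `g` fixes at least the fraction 1/`q` of the points, so the factor `n`
  -- cancels from the double count.
  class-≤ : 0 < n → ∀ c q → (∀ v → ∣stab∣ X v ≤ c) → n ≤ fixCount g * q → length conjugates ≤ c * q
  class-≤ 0<n c q stab≤c n≤fix*q = *-cancelˡ-≤ n {{>-nonZero 0<n}} (begin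
    n * k                   ≡⟨ *-comm n k ⟩
    k * n                   ≤⟨ *-monoʳ-≤ k n≤fix*q ⟩
    k * (fixCount g * q)    ≡⟨ *-assoc k (fixCount g) q ⟨
    k * fixCount g * q      ≤⟨ *-monoˡ-≤ q (class*fixCount-≤ c stab≤c) ⟩
    n * c * q               ≡⟨ *-assoc n c q ⟩
    n * (c * q)             ∎)
    where
    open ≤-Reasoning
    k = length conjugates

  order-conjugate : ∀ k → pow g k ≡ idₜ → ∀ s → s ∈ conjugates → pow s k ≡ idₜ
  order-conjugate k gᵏ≡id s s∈ =
    let s∈X , h , h∈X , gh≡hs = ∈-conjugates⁻ s∈
    in ∘ₜ-cancelˡ h (perms X h h∈X) (pow s k) idₜ (begin
         h ∘ₜ pow s k   ≡⟨ pow-intertwine g h s gh≡hs k ⟨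
         pow g k ∘ₜ h   ≡⟨ cong (_∘ₜ h) gᵏ≡id ⟩
         idₜ ∘ₜ h       ≡⟨ ∘ₜ-identityˡ h ⟩
         h              ≡⟨ ∘ₜ-identityʳ h ⟨
         h ∘ₜ idₜ       ∎)
    where open ≡-Reasoning

  prod∈X : ∀ {w} → All (_∈ conjugates) w → prod w ∈ elems X
  prod∈X []        = hasId X
  prod∈X (x∈ ∷ w∈) = closed X _ _ (proj₁ (∈-conjugates⁻ x∈)) (prod∈X w∈)

  conjugate-word : ∀ h → h ∈ elems X → ∀ {w} → All (_∈ conjugates) w →
    ∃ λ w′ → All (_∈ conjugates) w′ × prod w ∘ₜ h ≡ h ∘ₜ prod w′
  conjugate-word h h∈X [] = [] , [] , trans (∘ₜ-identityˡ h) (≡-sym (∘ₜ-identityʳ h))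
  conjugate-word h h∈X {x ∷ w} (x∈ ∷ w∈) =
    let y , y∈ , xh≡hy = conjugates-closed x h x∈ h∈X
        w′ , w′∈ , eq = conjugate-word h h∈X w∈
    in y ∷ w′ , y∈ ∷ w′∈ , (begin
         (x ∘ₜ prod w) ∘ₜ h     ≡⟨ ∘ₜ-assoc x (prod w) h ⟩
         x ∘ₜ (prod w ∘ₜ h)     ≡⟨ cong (x ∘ₜ_) eq ⟩
         x ∘ₜ (h ∘ₜ prod w′)    ≡⟨ slide x h h y (prod w′) xh≡hy ⟩
         h ∘ₜ (y ∘ₜ prod w′)    ∎)
    where open ≡-Reasoning

  module NormalClosure (c r : ℕ) (r<c : r < c) (gʳ≡id : pow g (suc r) ≡ idₜ) where

    open Dietzmann conjugates
      (λ x s x∈ s∈ → conjugates-closed x s x∈ (proj₁ (∈-conjugates⁻ s∈)))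
      c (λ s s∈ → r , r<c , order-conjugate (suc r) gʳ≡id s s∈)

    short : List (Tab n)
    short = products conjugates (length conjugates * c)

    short? : ∀ x → Dec (x ∈ short)
    short? x = any? (x ≟ₜ_) short

    -- Together with `word` this identifies the filtered list with all products of conjugates: by
    -- Dietzmann's lemma no product, however long, falls outside `short`. Closure under composition
    -- is then concatenation of words.
    prod∈ : ∀ {w} → All (_∈ conjugates) w → prod w ∈ filter short? (elems X)
    prod∈ w∈ = ∈-filter⁺ short? (prod∈X w∈) (prod∈products _ w∈)

    word : ∀ {x} → x ∈ filter short? (elems X) → ∃ λ w → All (_∈ conjugates) w × x ≡ prod w
    word x∈ = ∈-products⁻ (length conjugates * c) (proj₂ (∈-filter⁻ short? {xs = elems X} x∈))

    normalClosure : PermGroup n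
    normalClosure = record
      { elems  = filter short? (elems X)
      ; unique = Uniqueₚ.filter⁺ short? (unique X)
      ; perms  = λ σ σ∈ → perms X σ (proj₁ (∈-filter⁻ short? {xs = elems X} σ∈))
      ; hasId  = prod∈ []
      ; closed = closed′
      }
      where
      closed′ : ∀ σ τ → σ ∈ filter short? (elems X) → τ ∈ filter short? (elems X) →
        (σ ∘ₜ τ) ∈ filter short? (elems X)
      closed′ σ τ σ∈ τ∈ with v , v∈ , refl ← word σ∈ with w , w∈ , refl ← word τ∈ =
        subst (_∈ filter short? (elems X)) (prod-++ v w) (prod∈ (Allₚ.++⁺ v∈ w∈))

    normalClosure-⊴ : normalClosure ⊴ X
    normalClosure-⊴ = (λ σ σ∈ → proj₁ (∈-filter⁻ short? {xs = elems X} σ∈)) , normal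
      where
      normal : ∀ h m → h ∈ elems X → m ∈ elems normalClosure →
        ∃ λ m′ → m′ ∈ elems normalClosure × h ∘ₜ m ≡ m′ ∘ₜ h
      normal h m h∈X m∈ with w , w∈ , refl ← word m∈ =
        -- The definition of `⊴` puts `h` on the left of `m`, whereas `conjugate-word` moves its
        -- element from right to left; hence it is applied to the inverse of `h`.
        let h⁻¹ , h⁻¹∈X , hh⁻¹ , h⁻¹h = inverse X h h∈X
            w′ , w′∈ , eq = conjugate-word h⁻¹ h⁻¹∈X w∈
        in prod w′ , prod∈ w′∈ , (begin
             h ∘ₜ prod w                     ≡⟨ ∘ₜ-identityʳ (h ∘ₜ prod w) ⟨
             (h ∘ₜ prod w) ∘ₜ idₜ            ≡⟨ cong ((h ∘ₜ prod w) ∘ₜ_) h⁻¹h ⟨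
             (h ∘ₜ prod w) ∘ₜ (h⁻¹ ∘ₜ h)     ≡⟨ ∘ₜ-assoc h (prod w) (h⁻¹ ∘ₜ h) ⟩
             h ∘ₜ (prod w ∘ₜ (h⁻¹ ∘ₜ h))     ≡⟨ cong (h ∘ₜ_) (slide (prod w) h⁻¹ h⁻¹ (prod w′) h eq) ⟩
             h ∘ₜ (h⁻¹ ∘ₜ (prod w′ ∘ₜ h))    ≡⟨ ∘ₜ-assoc h h⁻¹ (prod w′ ∘ₜ h) ⟨
             (h ∘ₜ h⁻¹) ∘ₜ (prod w′ ∘ₜ h)    ≡⟨ cong (_∘ₜ (prod w′ ∘ₜ h)) hh⁻¹ ⟩
             idₜ ∘ₜ (prod w′ ∘ₜ h)           ≡⟨ ∘ₜ-identityˡ (prod w′ ∘ₜ h) ⟩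
             prod w′ ∘ₜ h                    ∎)
        where open ≡-Reasoning

    self∈normalClosure : g ∈ elems normalClosure
    self∈normalClosure = subst (_∈ elems normalClosure) (∘ₜ-identityʳ g) (prod∈ (self∈conjugates ∷ []))

    ∣normalClosure∣-≤ : ∀ K → length conjugates ≤ K → ∣ normalClosure ∣ᴳ ≤ suc K ^ (K * c)
    ∣normalClosure∣-≤ K k≤K = begin
      ∣ normalClosure ∣ᴳ      ≤⟨ length-≤-injection (unique normalClosure) (λ x → x) (λ _ _ eq → eq)
                                   (λ x x∈ → proj₂ (∈-filter⁻ short? {xs = elems X} x∈)) ⟩
      length short            ≡⟨ length-products conjugates (k * c) ⟩
      suc k ^ (k * c)         ≤⟨ ^-monoˡ-≤ (k * c) (s≤s k≤K) ⟩
      suc K ^ (k * c)         ≤⟨ ^-monoʳ-≤ (suc K) (*-monoˡ-≤ c k≤K) ⟩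
      suc K ^ (K * c)         ∎
      where
      open ≤-Reasoning
      k = length conjugates

-- Local actions of normal subgroups

-- Follow the walk until it first leaves `P`. With `P` the fixed points of a permutation, this finds
-- a fixed vertex with a moved neighbour.
exitEdge : ∀ {n} {Γ : Graph n} {P : Fin n → Set} → (∀ v → Dec (P v)) →
  ∀ {u v} → Walk Γ u v → P u → ¬ P v →
  ∃ λ a → ∃ λ b → adj Γ a b ≡ true × P a × ¬ P b
exitEdge P? here Pu ¬Pu = ⊥-elim (¬Pu Pu)
exitEdge P? (step {u} {a} ua walk) Pu ¬Pv with P? a
... | yes Pa = exitEdge P? walk Pa ¬Pv
... | no ¬Pa = u , a , ua , Pu , ¬Pa

module NormalSubgroup {n d : ℕ} (Γ : Graph n) (X : PermGroup n) (L : PermGroup d)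
  (connected : Connected Γ) (aut : IsAutGroup Γ X) (arc : ArcTransitive Γ X)
  (quasiprimitive : Quasiprimitive L) (locallyL : ∀ v → LocallyIso Γ X v L)
  (M : PermGroup n) (M⊴X : M ⊴ X) where

  M⊆X : ∀ {x} → x ∈ elems M → x ∈ elems X
  M⊆X = proj₁ M⊴X _

  preserves : ∀ {σ} → σ ∈ elems X → ∀ {u v} → adj Γ u v ≡ true → adj Γ (σ ⟪ u ⟫) (σ ⟪ v ⟫) ≡ true
  preserves σ∈X uv = trans (aut _ σ∈X _ _) uv

  -- Nothing is asked about the image of `v` under `x`: the orbit count only follows where
  -- neighbours go.
  TransitiveAt : Fin n → Set
  TransitiveAt v = ∀ a b → adj Γ v a ≡ true → adj Γ v b ≡ true →
    ∃ λ x → x ∈ elems M × x ⟪ a ⟫ ≡ b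

  module Local (v : Fin n) where

    β : Fin d → Fin n
    β = proj₁ (locallyL v)

    β-injective : ∀ i j → β i ≡ β j → i ≡ j
    β-injective = proj₁ (proj₂ (locallyL v))

    β-adj : ∀ i → adj Γ v (β i) ≡ true
    β-adj = proj₁ (proj₂ (proj₂ (locallyL v)))

    β-surjective : ∀ w → adj Γ v w ≡ true → ∃ λ i → β i ≡ w
    β-surjective = proj₁ (proj₂ (proj₂ (proj₂ (locallyL v))))

    Induces : Tab n → Tab d → Set
    Induces x τ = x ⟪ v ⟫ ≡ v × (∀ i → x ⟪ β i ⟫ ≡ β (τ ⟪ i ⟫))

    induced : ∀ x → x ∈ elems X → x ⟪ v ⟫ ≡ v → ∃ λ τ → τ ∈ elems L × Induces x τ
    induced x x∈X xv≡v =
      let τ , τ∈L , eq = proj₁ (proj₂ (proj₂ (proj₂ (proj₂ (locallyL v))))) x x∈X xv≡v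
      in τ , τ∈L , xv≡v , eq

    lift : ∀ τ → τ ∈ elems L → ∃ λ x → x ∈ elems X × Induces x τ
    lift = proj₂ (proj₂ (proj₂ (proj₂ (proj₂ (locallyL v)))))

    induces-∘ : ∀ {x y σ τ} → Induces x σ → Induces y τ → Induces (x ∘ₜ y) (σ ∘ₜ τ)
    induces-∘ {x} {y} {σ} {τ} (xv , xβ) (yv , yβ) =
        trans (∘ₜ-app x y v) (trans (cong (x ⟪_⟫) yv) xv)
      , λ i → begin
          (x ∘ₜ y) ⟪ β i ⟫        ≡⟨ ∘ₜ-app x y (β i) ⟩
          x ⟪ y ⟪ β i ⟫ ⟫         ≡⟨ cong (x ⟪_⟫) (yβ i) ⟩
          x ⟪ β (τ ⟪ i ⟫) ⟫       ≡⟨ xβ (τ ⟪ i ⟫) ⟩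
          β (σ ⟪ τ ⟪ i ⟫ ⟫)       ≡⟨ cong β (∘ₜ-app σ τ i) ⟨
          β ((σ ∘ₜ τ) ⟪ i ⟫)      ∎
      where open ≡-Reasoning

    InducedByM : Tab d → Set
    InducedByM τ = Any (λ x → Induces x τ) (elems M)

    inducedByM? : ∀ τ → Dec (InducedByM τ)
    inducedByM? τ =
      any? (λ x → (x ⟪ v ⟫ ≟F v) ×-dec all? (λ i → x ⟪ β i ⟫ ≟F β (τ ⟪ i ⟫))) (elems M)

    -- This is the action of the stabiliser of `v` in `M` on the neighbourhood, transported along
    -- `β`. Cutting it out of `elems L` makes it a duplicate-free list.
    localGroup : PermGroup d
    localGroup = record
      { elems  = filter inducedByM? (elems L)
      ; unique = Uniqueₚ.filter⁺ inducedByM? (unique L)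
      ; perms  = λ σ σ∈ → perms L σ (proj₁ (∈-filter⁻ inducedByM? {xs = elems L} σ∈))
      ; hasId  = ∈-filter⁺ inducedByM? (hasId L)
          (lose (hasId M) (idₜ-app v , λ i → trans (idₜ-app (β i)) (cong β (≡-sym (idₜ-app i)))))
      ; closed = λ σ τ σ∈ τ∈ →
          let σ∈L , Mσ = ∈-filter⁻ inducedByM? {xs = elems L} σ∈
              τ∈L , Mτ = ∈-filter⁻ inducedByM? {xs = elems L} τ∈
              x , x∈M , xσ = find Mσ
              y , y∈M , yτ = find Mτ
          in ∈-filter⁺ inducedByM? (closed L σ τ σ∈L τ∈L)
               (lose (closed M x y x∈M y∈M) (induces-∘ {x} {y} {σ} {τ} xσ yτ))
      }

    ∈-localGroup⁻ : ∀ {τ} → τ ∈ elems localGroup → ∃ λ x → x ∈ elems M × Induces x τ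
    ∈-localGroup⁻ τ∈ = find (proj₂ (∈-filter⁻ inducedByM? {xs = elems L} τ∈))

    -- Realise `μ` by an element of `M` and `γ` by an element of `X`, both fixing `v`, conjugate
    -- inside the normal subgroup `M`, and read off the permutation induced by the conjugate.
    localGroup-normal : ∀ γ μ → γ ∈ elems L → μ ∈ elems localGroup →
      ∃ λ τ → τ ∈ elems localGroup × γ ∘ₜ μ ≡ τ ∘ₜ γ
    localGroup-normal γ μ γ∈L μ∈
      with x , x∈M , xμ ← ∈-localGroup⁻ μ∈
      with h , h∈X , hγ ← lift γ γ∈L
      with y , y∈M , hx≡yh ← proj₂ M⊴X h x h∈X x∈M
      with τ , τ∈L , yτ ← induced y (M⊆X y∈M) (conjugate-fixes h x y hx≡yh v (proj₁ hγ) (proj₁ xμ))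
      = τ , ∈-filter⁺ inducedByM? τ∈L (lose y∈M yτ) , tab-ext λ i → β-injective _ _ (begin
           β ((γ ∘ₜ μ) ⟪ i ⟫)   ≡⟨ proj₂ (induces-∘ {h} {x} {γ} {μ} hγ xμ) i ⟨
           (h ∘ₜ x) ⟪ β i ⟫     ≡⟨ app-cong hx≡yh (β i) ⟩
           (y ∘ₜ h) ⟪ β i ⟫     ≡⟨ proj₂ (induces-∘ {y} {h} {τ} {γ} yτ hγ) i ⟩
           β ((τ ∘ₜ γ) ⟪ i ⟫)   ∎)
      where open ≡-Reasoning

    localGroup-⊴ : localGroup ⊴ L
    localGroup-⊴ = (λ σ σ∈ → proj₁ (∈-filter⁻ inducedByM? {xs = elems L} σ∈)) , localGroup-normal

    localGroup-nontrivial : ∀ x w → x ∈ elems M → x ⟪ v ⟫ ≡ v → adj Γ v w ≡ true → x ⟪ w ⟫ ≢ w →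
      Nontrivial localGroup
    localGroup-nontrivial x w x∈M xv≡v vw xw≢w
      with τ , τ∈L , xτ ← induced x (M⊆X x∈M) xv≡v
      with i , refl ← β-surjective w vw
      = τ , ∈-filter⁺ inducedByM? τ∈L (lose x∈M xτ) , λ τ≡id →
          xw≢w (trans (proj₂ xτ i) (cong β (trans (app-cong τ≡id i) (idₜ-app i))))

    -- Quasiprimitivity of `L` makes its nontrivial normal subgroup `localGroup` transitive.
    transitiveAt : Nontrivial localGroup → TransitiveAt v
    transitiveAt nontrivial a b va vb
      with i , refl ← β-surjective a va
      with j , refl ← β-surjective b vb
      with σ , σ∈ , σi≡j ← quasiprimitive localGroup localGroup-⊴ nontrivial i j
      with y , y∈M , yσ ← ∈-localGroup⁻ σ∈
      = y , y∈M , trans (proj₂ yσ i) (cong β σi≡j)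

  pullBack : ∀ h h⁻¹ → h⁻¹ ∈ elems X → h⁻¹ ∘ₜ h ≡ idₜ →
    ∀ {v u} → adj Γ (h ⟪ v ⟫) u ≡ true → adj Γ v (h⁻¹ ⟪ u ⟫) ≡ true
  pullBack h h⁻¹ h⁻¹∈X h⁻¹h {v} {u} hvu =
    subst (λ z → adj Γ z (h⁻¹ ⟪ u ⟫) ≡ true) (app-inverse h⁻¹ h h⁻¹h v) (preserves h⁻¹∈X hvu)

  -- Pull the two neighbours back by `h`, move one to the other within `M`, and conjugate the mover
  -- by `h`; normality keeps it in `M`.
  transitiveAt-image : ∀ h → h ∈ elems X → ∀ v → TransitiveAt v → TransitiveAt (h ⟪ v ⟫)
  transitiveAt-image h h∈X v trans-v a b hva hvb
    with h⁻¹ , h⁻¹∈X , hh⁻¹ , h⁻¹h ← inverse X h h∈X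
    with x , x∈M , xa≡b ← trans-v (h⁻¹ ⟪ a ⟫) (h⁻¹ ⟪ b ⟫) (pullBack h h⁻¹ h⁻¹∈X h⁻¹h hva) (pullBack h h⁻¹ h⁻¹∈X h⁻¹h hvb)
    with y , y∈M , hx≡yh ← proj₂ M⊴X h x h∈X x∈M
    = y , y∈M , (begin
         y ⟪ a ⟫                   ≡⟨ cong (y ⟪_⟫) (app-inverse h h⁻¹ hh⁻¹ a) ⟨
         y ⟪ h ⟪ h⁻¹ ⟪ a ⟫ ⟫ ⟫     ≡⟨ app-square h x y h hx≡yh _ ⟨
         h ⟪ x ⟪ h⁻¹ ⟪ a ⟫ ⟫ ⟫     ≡⟨ cong (h ⟪_⟫) xa≡b ⟩
         h ⟪ h⁻¹ ⟪ b ⟫ ⟫           ≡⟨ app-inverse h h⁻¹ hh⁻¹ b ⟩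
         b                         ∎)
    where open ≡-Reasoning

  transitiveEverywhere : ∀ v w → adj Γ v w ≡ true → TransitiveAt v → ∀ u → TransitiveAt u
  transitiveEverywhere v w vw trans-v u =
    -- The index `i` shows that the degree `d` is positive, so `u` also has a neighbour
    -- `Local.β u i`; arc-transitivity then carries `v` to `u`.
    let i , _ = Local.β-surjective v w vw
        h , h∈X , hv≡u , _ = arc v w u (Local.β u i) vw (Local.β-adj u i)
    in subst TransitiveAt hv≡u (transitiveAt-image h h∈X v trans-v)

  orbit : Fin n → List (Fin n)
  orbit v = map (_⟪ v ⟫) (elems M)

  InOrbit : Fin n → Fin n → Set
  InOrbit v u = ∃ λ x → x ∈ elems M × x ⟪ v ⟫ ≡ u

  -- Along a walk from `v`, each edge passes from the orbit of one end of the edge `v w` to the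
  -- orbit of the other.
  twoOrbits : ∀ v w → adj Γ v w ≡ true → (∀ u → TransitiveAt u) →
    ∀ u → InOrbit v u ⊎ InOrbit w u
  twoOrbits v w vw trans-all u = follow (connected v u) (inj₁ (idₜ , hasId M , idₜ-app v))
    where
    -- If `x` sends `v` to `a`, then `x ⟪ w ⟫` and `b` are both neighbours of `a`, so some element
    -- of `M` sends the former to the latter.
    cross : ∀ {v w} → adj Γ v w ≡ true → ∀ {a b} → adj Γ a b ≡ true → InOrbit v a → InOrbit w b
    cross {v} {w} vw {a} {b} ab (x , x∈M , refl) =
      let y , y∈M , yxw≡b = trans-all a (x ⟪ w ⟫) b (preserves (M⊆X x∈M) vw) ab
      in y ∘ₜ x , closed M y x y∈M x∈M , trans (∘ₜ-app y x w) yxw≡b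
    wv : adj Γ w v ≡ true
    wv = trans (sym Γ w v) vw
    follow : ∀ {a b} → Walk Γ a b → InOrbit v a ⊎ InOrbit w a → InOrbit v b ⊎ InOrbit w b
    follow here         a∈        = a∈
    follow (step ab bc) (inj₁ a∈) = follow bc (inj₂ (cross vw ab a∈))
    follow (step ab bc) (inj₂ a∈) = follow bc (inj₁ (cross wv ab a∈))

  covered : ∀ v w → adj Γ v w ≡ true → (∀ u → TransitiveAt u) → ∀ u → u ∈ orbit v ++ orbit w
  covered v w vw trans-all u with twoOrbits v w vw trans-all u
  ... | inj₁ (y , y∈M , refl) = ∈-++⁺ˡ (∈-map⁺ (_⟪ v ⟫) y∈M)
  ... | inj₂ (y , y∈M , refl) = ∈-++⁺ʳ (orbit v) (∈-map⁺ (_⟪ w ⟫) y∈M)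

  length-orbit : ∀ v → length (orbit v) ≡ ∣ M ∣ᴳ
  length-orbit v = length-map (_⟪ v ⟫) (elems M)

  degree-≤-transitive : ∀ v w → adj Γ v w ≡ true → (∀ u → TransitiveAt u) → n ≤ ∣ M ∣ᴳ + ∣ M ∣ᴳ
  degree-≤-transitive v w vw trans-all =
    subst₂ _≤_ (length-tabulate (λ (i : Fin n) → i))
      (trans (length-++ (orbit v)) (cong₂ _+_ (length-orbit v) (length-orbit w)))
      (length-≤-injection (Uniqueₚ.allFin⁺ n) (λ i → i) (λ _ _ eq → eq)
        (λ u _ → covered v w vw trans-all u))

  -- A walk from the fixed vertex `v` to a moved one has an edge from a fixed `a` to a moved `b`.
  -- There `x` induces a nontrivial local permutation, so `M` is transitive on neighbours at `a` and
  -- hence everywhere.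
  degree-≤ : ∀ x → x ∈ elems M → x ≢ idₜ → ∀ v → x ⟪ v ⟫ ≡ v → n ≤ ∣ M ∣ᴳ + ∣ M ∣ᴳ
  degree-≤ x x∈M x≢id v xv≡v
    with u , xu≢u ← movedPoint x x≢id
    with a , b , ab , xa≡a , xb≢b ← exitEdge (λ z → x ⟪ z ⟫ ≟F z) (connected v u) xv≡v xu≢u
    = degree-≤-transitive a b ab (transitiveEverywhere a b ab
        (Local.transitiveAt a (Local.localGroup-nontrivial a x b x∈M xa≡a ab xb≢b)))

-- Fixed-point ratios

-- A positive rational has numerator at least 1, so it is at least the reciprocal of its
-- denominator; cross-multiplying gives the bound.
α≤fpr⇒n≤fixCount*↧α : ∀ α → Positive α → ∀ {n} (g : Tab n) → α ≤ℚ fpr g → n ≤ fixCount g * ↧ₙ α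
α≤fpr⇒n≤fixCount*↧α α α>0 {zero} g α≤fpr = z≤n
α≤fpr⇒n≤fixCount*↧α (mkℚ (ℤ.+ suc p) e-1 _) α>0 {suc n} g α≤fpr
  with ℚᵘ.*≤* ineq ← ℚᵘₚ.≤-respʳ-≃ (ℚₚ.toℚᵘ-fromℚᵘ (ℚᵘ.mkℚᵘ (ℤ.+ fixCount g) n)) (ℚₚ.toℚᵘ-mono-≤ α≤fpr)
  = ≤-trans (m≤m+n (suc n) (p * suc n))
      (ℤₚ.drop‿+≤+ (subst (ℤ.+ (suc p * suc n) ℤ.≤_) (≡-sym (ℤₚ.pos-* (fixCount g) (suc e-1))) ineq))

fixedVertex : ∀ {n} (g : Tab n) → 0 < fixCount g → ∃ λ v → g ⟪ v ⟫ ≡ v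
fixedVertex {n} g pos = nonEmpty (filter fixed? (allFin n)) pos λ v∈ → proj₂ (∈-filter⁻ fixed? {xs = allFin n} v∈)
  where
  fixed? = λ i → g ⟪ i ⟫ ≟F i
  nonEmpty : ∀ vs → 0 < length vs → (∀ {v} → v ∈ vs → g ⟪ v ⟫ ≡ v) → ∃ λ v → g ⟪ v ⟫ ≡ v
  nonEmpty (v ∷ _) _ fixes = v , fixes (here refl)

-- Bounding the number of vertices

-- This is the bound of `∣normalClosure∣-≤` at `c * q`, the estimate for the size of the conjugacy
-- class.
closureBound : ℕ → ℕ → ℕ
closureBound c q = suc (c * q) ^ (c * q * c)

fewVertices : ∀ {n d} (Γ : Graph n) (X : PermGroup n) (L : PermGroup d) →
  Connected Γ → IsAutGroup Γ X → ArcTransitive Γ X →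
  Quasiprimitive L → (∀ v → LocallyIso Γ X v L) →
  ∀ c q → (∀ v → ∣stab∣ X v ≤ c) →
  ∀ g → g ∈ elems X → g ≢ idₜ → 0 < n → n ≤ fixCount g * q →
  n ≤ closureBound c q + closureBound c q
fewVertices {n} Γ X L connected aut arc quasiprimitive locallyL c q stab≤c g g∈X g≢id 0<n n≤fix*q
  -- With no fixed vertex, `n≤fix*q` would force `n` to be 0.
  with v , gv≡v ← fixedVertex g (n≢0⇒n>0 λ fix≡0 → <⇒≱ 0<n (subst (λ f → n ≤ f * q) fix≡0 n≤fix*q))
  with r , r<∣stab∣ , gʳ≡id ← order-≤-stab X g v g∈X gv≡v
  = ≤-trans (degree-≤ g self∈normalClosure g≢id v gv≡v) (+-mono-≤ ∣M∣≤ ∣M∣≤)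
  where
  open ConjugacyClass X g g∈X
  open NormalClosure c r (≤-trans r<∣stab∣ (stab≤c v)) gʳ≡id
  open NormalSubgroup Γ X L connected aut arc quasiprimitive locallyL normalClosure normalClosure-⊴
  ∣M∣≤ : ∣ normalClosure ∣ᴳ ≤ closureBound c q
  ∣M∣≤ = ∣normalClosure∣-≤ (c * q) (class-≤ 0<n c q stab≤c n≤fix*q)

theorem9 : ∀ d (L : PermGroup d) → Quasiprimitive L → GraphRestrictive L →
    (α : ℚ) → Positive α →
    Σ ℕ λ N → ∀ n (Γ : Graph n) (X : PermGroup n) → Connected Γ →
    IsAutGroup Γ X → ArcTransitive Γ X → N < n →
    (∀ v → LocallyIso Γ X v L) →
    ∀ g → g ∈ elems X → g ≢ idₜ → fpr g <ℚ α
theorem9 d L quasiprimitive (c , restrictive) α α>0 =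
  -- One summand for each of the at most two orbits of the normal closure; only `c` and the
  -- denominator of `α` enter.
  closureBound c (↧ₙ α) + closureBound c (↧ₙ α) ,
  λ n Γ X connected aut arc N<n locallyL g g∈X g≢id →
    decidable-stable (fpr g ℚₚ.<? α) λ fpr≮α →
      <⇒≱ N<n (fewVertices Γ X L connected aut arc quasiprimitive locallyL c (↧ₙ α)
        (restrictive n Γ X connected aut arc locallyL) g g∈X g≢id
        (≤-<-trans z≤n N<n) (α≤fpr⇒n≤fixCount*↧α α α>0 g (ℚₚ.≮⇒≥ fpr≮α)))
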